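{- Let $G=(V,E)$ be a finite simple undirected graph, let $\kappa$ be a positive integer, let $p\in P_\kappa(A)$, and let $s$ and $t$ be, respectively, the source (first vertex) and sink (last vertex) of $p$. The inequality \[\sum_{(i,j)\in p} w_{ij}-z\le 0\] defines a facet of $P_{G,\kappa}$ if and only if $[s,t]\notin E$.
   Context: Let $m=|E|$. Let $D=(V,A)$ be the directed graph with $A=\{(i,j),(j,i)\mid [i,j]\in E\}$. Paths are directed and elementary (no repeated vertices); paths and cycles are identified with their arc sets. $P_\kappa(A)$ denotes the set of all paths in $D$ with exactly $\kappa$ arcs, and $C(A)$ the set of all directed (elementary) cycles in $D$ (including those of length 2), with $|C|$ the number of arcs of $C$. The polytope $P_{G,\kappa}$ is the convex hull of all $(w,z)\in\mathbb{R}^{2m}\times\mathbb{R}$, $w=(w_{ij})_{(i,j)\in A}$, satisfying (1) $w_{ij}+w_{ji}\le 1$ for all $[i,j]\in E$; (2) $\sum_{(i,j)\in C}w_{ij}\le |C|-1$ for all $C\in C(A)$; (3) $\sum_{(i,j)\in p}w_{ij}\le z$ for all $p\in P_\kappa(A)$; (4) $w_{ij}\in\{0,1\}$ for all $(i,j)\in A$; (5) $0\le z\le\kappa$. An inequality defines a facet of $P_{G,\kappa}$ if it is valid for $P_{G,\kappa}$ and the set of points of $P_{G,\kappa}$ satisfying it with equality has dimension $\dim(P_{G,\kappa})-1$. -}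

module Defs where

open import Level using (_⊔_; 0ℓ) renaming (suc to lsuc)
open import Algebra.Apartness.Bundles using (HeytingField)
open import Algebra.Bundles using (CommutativeRing)
import Algebra.Definitions.RawMonoid as RawMonoidDefs
open import Data.Fin.Base using (Fin; zero; suc; inject₁; fromℕ)
open import Data.Integer.Base using (ℤ; +_; 1ℤ) renaming (_-_ to _-ℤ_)
open import Data.Nat.Base as ℕ using (ℕ)
open import Data.Product.Base using (Σ; ∃-syntax; _×_; _,_)
open import Data.Sum.Base using (_⊎_; inj₁; inj₂)
open import Data.Unit.Base using (⊤; tt)
open import Function.Definitions using (Injective)
open import Relation.Binary.Core using (Rel)
open import Relation.Binary.Definitions using (Decidable; Symmetric; Irreflexive)
open import Relation.Binary.PropositionalEquality.Core using (_≡_)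
open import Relation.Binary.Structures using (IsStrictPartialOrder)
open import Relation.Nullary.Negation using (¬_)
open import Relation.Unary using (Pred; _∈_)

------------------------------------------------------------------------
-- The real numbers

-- The order is not assumed to be decidable, so that constructive models
-- of the real numbers qualify.  Cotransitivity of _<_ follows from that
-- of _#_.
record OrderedField c ℓ₁ ℓ₂ : Set (lsuc (c ⊔ ℓ₁ ⊔ ℓ₂)) where
  infix 4 _<_ _≤_
  field
    heytingField : HeytingField c ℓ₁ ℓ₂

  open HeytingField heytingField public

  field
    _<_                  : Rel Carrier ℓ₂
    isStrictPartialOrder : IsStrictPartialOrder _≈_ _<_
    #⇒<⊎>                : ∀ {x y} → x # y → x < y ⊎ y < x
    <⇒#                  : ∀ {x y} → x < y → x # y
    +-monoˡ-<            : ∀ z {x y} → x < y → x + z < y + z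
    *-pos                : ∀ {x y} → 0# < x → 0# < y → 0# < x * y

  _≤_ : Rel Carrier ℓ₂
  x ≤ y = ¬ (y < x)

  commutativeRing : CommutativeRing c ℓ₁
  commutativeRing = record { isCommutativeRing = isCommutativeRing }

  open RawMonoidDefs (CommutativeRing.+-rawMonoid commutativeRing) public
    using (sum) renaming (_×_ to _·_)

  fromNat : ℕ → Carrier
  fromNat n = n · 1#

-- ℝ is characterised, up to isomorphism, as the Archimedean and Cauchy
-- complete ordered field; the standard library has no construction of it.
record RealNumbers c ℓ₁ ℓ₂ : Set (lsuc (c ⊔ ℓ₁ ⊔ ℓ₂)) where
  field
    orderedField : OrderedField c ℓ₁ ℓ₂

  open OrderedField orderedField public

  IsCauchy : (ℕ → Carrier) → Set (c ⊔ ℓ₂)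
  IsCauchy s = ∀ ε → 0# < ε →
    ∃[ N ] (∀ i j → N ℕ.≤ i → N ℕ.≤ j → s i - s j < ε)

  ConvergesTo : (ℕ → Carrier) → Carrier → Set (c ⊔ ℓ₂)
  ConvergesTo s l = ∀ ε → 0# < ε →
    ∃[ N ] (∀ i → N ℕ.≤ i → (s i - l < ε) × (l - s i < ε))

  field
    archimedean : ∀ x → ∃[ n ] (x < fromNat n)
    complete    : ∀ s → IsCauchy s → ∃[ l ] ConvergesTo s l

------------------------------------------------------------------------
-- Graphs, directed paths and cycles

record SimpleGraph (n : ℕ) : Set₁ where
  infix 4 _~_ _~?_
  field
    _~_      : Rel (Fin n) 0ℓ
    ~-sym    : Symmetric _~_
    ~-irrefl : Irreflexive _≡_ _~_
    _~?_     : Decidable _~_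

module _ {n : ℕ} (G : SimpleGraph n) where
  open SimpleGraph G

  -- The arcs of the bidirected graph D.  Adjacency is an irrelevant field,
  -- so that an arc is determined by its two endpoints.
  record Arc : Set where
    constructor arc
    field
      src tgt : Fin n
      .adj    : src ~ tgt

  reverse : Arc → Arc
  reverse (arc i j e) = arc j i (~-sym e)

  record Path (κ : ℕ) : Set where
    field
      vertex     : Fin (ℕ.suc κ) → Fin n
      elementary : Injective _≡_ _≡_ vertex
      linked     : ∀ (i : Fin κ) → vertex (inject₁ i) ~ vertex (suc i)

    source sink : Fin n
    source = vertex zero
    sink   = vertex (fromℕ κ)

    arcs : Fin κ → Arc
    arcs i = arc (vertex (inject₁ i)) (vertex (suc i)) (linked i)

  -- A directed cycle, cut open at one of its vertices: an elementary path
  -- together with an arc from its sink back to its source.  There are no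
  -- loops, so the path has at least one arc; cycles of length 2 do occur.
  record Cycle : Set where
    field
      {pathLength} : ℕ
      path         : Path pathLength

    open Path path using (source; sink)

    field
      closing : sink ~ source

    length : ℕ
    length = ℕ.suc pathLength

    arcs : Fin length → Arc
    arcs zero    = arc sink source closing
    arcs (suc i) = Path.arcs path i

------------------------------------------------------------------------
-- Convexity, dimension and facets in the real vector space I → ℝ

module Polyhedral {c ℓ₁ ℓ₂} (ℝ : RealNumbers c ℓ₁ ℓ₂) {I : Set} where
  open RealNumbers ℝ

  Point : Set c
  Point = I → Carrier

  conv : ∀ {ℓ} → Pred Point ℓ → Pred Point (c ⊔ ℓ₁ ⊔ ℓ₂ ⊔ ℓ)
  conv S x = ∃[ k ] Σ (Fin k → Point) λ y → Σ (Fin k → Carrier) λ μ →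
    (∀ i → y i ∈ S) ×
    (∀ i → 0# ≤ μ i) ×
    (sum μ ≈ 1#) ×
    (∀ a → x a ≈ sum (λ i → μ i * y i a))

  AffinelyIndependent : ∀ {k} → (Fin k → Point) → Set (c ⊔ ℓ₁)
  AffinelyIndependent {k} y = ∀ (μ : Fin k → Carrier) →
    sum μ ≈ 0# →
    (∀ a → sum (λ i → μ i * y i a) ≈ 0#) →
    ∀ i → μ i ≈ 0#

  -- The dimension is one less than the maximum number of affinely
  -- independent points; in particular it is -1 for the empty set.
  HasDimension : ∀ {ℓ} → Pred Point ℓ → ℤ → Set (c ⊔ ℓ₁ ⊔ ℓ)
  HasDimension S d = ∃[ r ]
    (d ≡ + r -ℤ 1ℤ) ×
    (Σ (Fin r → Point) λ y → (∀ i → y i ∈ S) × AffinelyIndependent y) ×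
    (∀ k (y : Fin k → Point) → (∀ i → y i ∈ S) → AffinelyIndependent y → k ℕ.≤ r)

  -- Inequalities  f x ≤ β  are given by their left- and right-hand sides; f is
  -- meant to be a linear form.
  Valid : ∀ {ℓ} → Pred Point ℓ → (Point → Carrier) → Carrier → Set (c ⊔ ℓ₂ ⊔ ℓ)
  Valid P f β = ∀ x → x ∈ P → f x ≤ β

  Face : ∀ {ℓ} → Pred Point ℓ → (Point → Carrier) → Carrier → Pred Point (ℓ₁ ⊔ ℓ)
  Face P f β x = x ∈ P × f x ≈ β

  DefinesFacet : ∀ {ℓ} → Pred Point ℓ → (Point → Carrier) → Carrier → Set (c ⊔ ℓ₁ ⊔ ℓ₂ ⊔ ℓ)
  DefinesFacet P f β = Valid P f β ×
    ∃[ d ] HasDimension P d × HasDimension (Face P f β) (d -ℤ 1ℤ)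

------------------------------------------------------------------------
-- The polytope P_{G,κ}

module _ {c ℓ₁ ℓ₂} (ℝ : RealNumbers c ℓ₁ ℓ₂) {n : ℕ} (G : SimpleGraph n) where
  open RealNumbers ℝ
  open Polyhedral ℝ

  -- The space ℝ^A × ℝ of pairs (w , z).
  Coordinate : Set
  Coordinate = Arc G ⊎ ⊤

  wᶜ : Point {I = Coordinate} → Arc G → Carrier
  wᶜ x a = x (inj₁ a)

  zᶜ : Point {I = Coordinate} → Carrier
  zᶜ x = x (inj₂ tt)

  pathSum : ∀ {κ} → Path G κ → (Arc G → Carrier) → Carrier
  pathSum p w = sum (λ i → w (Path.arcs p i))

  cycleSum : Cycle G → (Arc G → Carrier) → Carrier
  cycleSum C w = sum (λ i → w (Cycle.arcs C i))

  record Feasible (κ : ℕ) (x : Point {I = Coordinate}) : Set (c ⊔ ℓ₁ ⊔ ℓ₂) where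
    private
      w = wᶜ x
      z = zᶜ x
    field
      edge≤1   : ∀ a → w a + w (reverse G a) ≤ 1#
      cycle≤   : ∀ C → cycleSum C w ≤ fromNat (Cycle.length C) - 1#
      path≤z   : ∀ (p : Path G κ) → pathSum p w ≤ z
      binary   : ∀ a → w a ≈ 0# ⊎ w a ≈ 1#
      0≤z      : 0# ≤ z
      z≤κ      : z ≤ fromNat κ

  Polytope : ℕ → Pred (Point {I = Coordinate}) (c ⊔ ℓ₁ ⊔ ℓ₂)
  Polytope κ = conv (Feasible κ)

{-# OPTIONS --safe #-}

-- Suppose s ~ t and w_ts = 1 at a feasible point of the face.  Every rotation of
-- the cycle formed by p and (t , s), cut open, is a path of length κ and so bounds
-- z from below; applied in turn, these bounds force one arc of p after another to
-- carry 1, until the cycle inequality is violated.  So w_ts vanishes on the face,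
-- which is therefore not a facet.
--
-- Suppose s ≁ t.  The following points of the face, one for each arc a, are affinely
-- independent together with the origin: a alone with z = 1 if a lies on p; a and
-- an arc of p with the same tail or the same head, again with z = 1, if there is
-- one; and otherwise all of p and a with z = κ, which is acyclic because a ≠ (t , s).
module Submission where

open import Defs
open import Level using (_⊔_; 0ℓ)
import Algebra.Apartness.Properties.HeytingCommutativeRing as ApartnessProperties
open import Algebra.Bundles using (CommutativeRing)
import Algebra.Properties.CommutativeMonoid.Sum as SumProperties
import Algebra.Properties.Ring as RingProperties
import Algebra.Properties.Semiring.Sum as SemiringSumProperties
open import Data.Fin.Base using (Fin; zero; suc; inject₁; fromℕ; toℕ; punchIn; punchOut)
import Data.Fin.Properties as Fin
open import Data.Fin.Relation.Unary.Top using (view; ‵fromℕ; ‵inject₁)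
open import Data.Integer.Base using (+_; 1ℤ; -1ℤ) renaming (_-_ to _-ℤ_)
import Data.Integer.Properties as ℤ
open import Algebra.Properties.AbelianGroup ℤ.+-0-abelianGroup using (∙-cancelʳ)
open import Data.List.Base as List using (List; concatMap; allFin; deduplicate)
open import Data.List.Membership.Propositional using (lose) renaming (_∈_ to _∈ˡ_)
open import Data.List.Membership.Propositional.Properties
  using (∈-concatMap⁺; ∈-allFin; ∈-lookup; ∈-deduplicate⁺)
import Data.List.Relation.Unary.All as All
import Data.List.Relation.Unary.AllPairs as AllPairs
open import Data.List.Relation.Unary.Any as Any using (here)
open import Data.List.Relation.Unary.Any.Properties using (lookup-index)
open import Data.List.Relation.Unary.Unique.Propositional using (Unique)
import Data.List.Relation.Unary.Unique.DecPropositional.Properties as UniqueDec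
open import Data.Nat.Base as ℕ using (ℕ; zero; suc; NonZero)
import Data.Nat.Properties as ℕ
open import Data.Product.Base using (∃-syntax; _×_; _,_; proj₁; proj₂)
open import Data.Sum.Base using (_⊎_; inj₁; inj₂; [_,_]′)
open import Data.Unit.Base using (tt)
open import Data.Vec.Functional using (_∷_; init; last; removeAt)
open import Function.Base using (_∘_)
open import Function.Bundles using (_⇔_; mk⇔)
open import Function.Definitions using (Injective)
open import Relation.Binary.Definitions using (DecidableEquality)
open import Relation.Binary.PropositionalEquality as ≡ using (_≡_)
import Relation.Binary.Reasoning.Setoid as SetoidReasoning
open import Relation.Binary.Structures using (IsStrictPartialOrder)
open import Relation.Nullary.Decidable
  using (Dec; yes; no; decidable-stable; map′; recompute; _×-dec_; _⊎-dec_)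
open import Relation.Nullary.Negation using (¬_; contradiction)
open import Relation.Unary using (Pred; ∅; _∈_; Decidable)
open import Relation.Unary.Properties using (∅?)

-- Ordered fields without decidable order.

module OrderedFieldProperties {c ℓ₁ ℓ₂} (F : OrderedField c ℓ₁ ℓ₂) where
  open OrderedField F hiding (zero)
  open CommutativeRing commutativeRing public
    using (ring; semiring; +-commutativeMonoid)
  open ApartnessProperties heytingCommutativeRing public
    using (1#0; x-0≈x; invertibleˡ⇒#; #-congʳ)
  open RingProperties ring public
    using (-‿distribˡ-*; -‿distribʳ-*; -‿involutive; -1*x≈-x)
  open SumProperties +-commutativeMonoid public
    using (sum-cong-≋; ∑-distrib-+; sum-replicate-zero; sum-replicate; sum-init-last; sum-remove)
  open SemiringSumProperties semiring public
    using (*-distribˡ-sum; *-distribʳ-sum)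
  open IsStrictPartialOrder isStrictPartialOrder public
    using (<-respˡ-≈; <-respʳ-≈)
    renaming (irrefl to <-irrefl; trans to <-trans; asym to <-asym)
  open SetoidReasoning setoid

  private variable
    x y z u v : Carrier

  ≤-reflexive : x ≈ y → x ≤ y
  ≤-reflexive x≈y y<x = <-irrefl (sym x≈y) y<x

  <⇒≤ : x < y → x ≤ y
  <⇒≤ x<y y<x = <-asym x<y y<x

  <-cotrans : x < y → ∀ z → x < z ⊎ z < y
  <-cotrans x<y z with #-cotrans (<⇒# x<y) z
  ... | inj₁ x#z = [ inj₁ , (λ z<x → inj₂ (<-trans z<x x<y)) ]′ (#⇒<⊎> x#z)
  ... | inj₂ z#y = [ inj₂ , (λ y<z → inj₁ (<-trans x<y y<z)) ]′ (#⇒<⊎> z#y)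

  ≤-antisym : x ≤ y → y ≤ x → x ≈ y
  ≤-antisym x≤y y≤x = proj₁ (tight _ _) (λ x#y → [ y≤x , x≤y ]′ (#⇒<⊎> x#y))

  ≤-respˡ-≈ : x ≈ y → x ≤ z → y ≤ z
  ≤-respˡ-≈ x≈y x≤z z<y = x≤z (<-respʳ-≈ (sym x≈y) z<y)

  ≤-respʳ-≈ : y ≈ z → x ≤ y → x ≤ z
  ≤-respʳ-≈ y≈z x≤y z<x = x≤y (<-respˡ-≈ (sym y≈z) z<x)

  x+y-y≈x : ∀ x y → x + y - y ≈ x
  x+y-y≈x x y = begin
    x + y - y    ≈⟨ +-assoc x y (- y) ⟩
    x + (y - y)  ≈⟨ +-congˡ (-‿inverseʳ y) ⟩
    x + 0#       ≈⟨ +-identityʳ x ⟩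
    x            ∎

  x-y+y≈x : ∀ x y → x - y + y ≈ x
  x-y+y≈x x y = begin
    x - y + y      ≈⟨ +-assoc x (- y) y ⟩
    x + (- y + y)  ≈⟨ +-congˡ (-‿inverseˡ y) ⟩
    x + 0#         ≈⟨ +-identityʳ x ⟩
    x              ∎

  +-cancelʳ-< : ∀ z → x + z < y + z → x < y
  +-cancelʳ-< {x} {y} z lt =
    <-respˡ-≈ (x+y-y≈x x z) (<-respʳ-≈ (x+y-y≈x y z) (+-monoˡ-< (- z) lt))

  +-cancelˡ-< : ∀ z → z + x < z + y → x < y
  +-cancelˡ-< z lt = +-cancelʳ-< z (<-respˡ-≈ (+-comm z _) (<-respʳ-≈ (+-comm z _) lt))

  +-mono-≤ : x ≤ y → u ≤ v → x + u ≤ y + v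
  +-mono-≤ {x} {y} {u} {v} x≤y u≤v lt with <-cotrans lt (x + v)
  ... | inj₁ y+v<x+v = x≤y (+-cancelʳ-< v y+v<x+v)
  ... | inj₂ x+v<x+u = u≤v (+-cancelˡ-< x x+v<x+u)

  x<0⇒0<-x : x < 0# → 0# < - x
  x<0⇒0<-x {x} x<0 = +-cancelʳ-< x
    (<-respˡ-≈ (sym (+-identityˡ x)) (<-respʳ-≈ (sym (-‿inverseˡ x)) x<0))

  x≤y⇒x-y≤0 : x ≤ y → x - y ≤ 0#
  x≤y⇒x-y≤0 {x} {y} x≤y 0<x-y = x≤y (<-respˡ-≈ (+-identityˡ y)
    (<-respʳ-≈ (x-y+y≈x x y) (+-monoˡ-< y 0<x-y)))

  -- Apartness of 1 from 0 leaves two signs; if 1 were negative, -1 would be positive, and hence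
  -- also its square 1.
  0<1 : 0# < 1#
  0<1 with #⇒<⊎> 1#0
  ... | inj₂ 0<1 = 0<1
  ... | inj₁ 1<0 = contradiction 1<0 (<-asym (<-respʳ-≈ [-1][-1]≈1 (*-pos 0<-1 0<-1)))
    where
    0<-1 : 0# < - 1#
    0<-1 = x<0⇒0<-x 1<0

    [-1][-1]≈1 : - 1# * - 1# ≈ 1#
    [-1][-1]≈1 = begin
      - 1# * - 1#      ≈⟨ -‿distribˡ-* 1# (- 1#) ⟨
      - (1# * - 1#)    ≈⟨ -‿cong (*-identityˡ (- 1#)) ⟩
      - (- 1#)         ≈⟨ -‿involutive 1# ⟩
      1#               ∎

  1≉0 : ¬ (1# ≈ 0#)
  1≉0 1≈0 = <-irrefl (sym 1≈0) 0<1

  x<x+1 : ∀ x → x < x + 1#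
  x<x+1 x = <-respˡ-≈ (+-identityˡ x) (<-respʳ-≈ (+-comm 1# x) (+-monoˡ-< x 0<1))

  inverseˡ : x # 0# → ∃[ y ] (y * x ≈ 1#)
  inverseˡ {x} x#0 with #⇒invertible x#0
  ... | y , y*[x-0]≈1 , _ = y , trans (*-congˡ (sym (x-0≈x x))) y*[x-0]≈1

  *-#0ˡ : x * y # 0# → x # 0#
  *-#0ˡ {x} {y} xy#0 with inverseˡ xy#0
  ... | z , z*xy≈1 = invertibleˡ⇒# (z * y , (begin
    z * y * (x - 0#)  ≈⟨ *-congˡ (x-0≈x x) ⟩
    z * y * x         ≈⟨ *-assoc z y x ⟩
    z * (y * x)       ≈⟨ *-congˡ (*-comm y x) ⟩
    z * (x * y)       ≈⟨ z*xy≈1 ⟩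
    1#                ∎))

  *-#0ʳ : x * y # 0# → y # 0#
  *-#0ʳ {x} {y} xy#0 = *-#0ˡ {y} {x} (#-congʳ (*-comm x y) xy#0)

  -- The hypothesis on `y` is a mere negation and yields no inverse. Tightness reduces the goal to
  -- refuting `x # 0#`, where `x` can be inverted instead.
  xy≈0∧y≉0⇒x≈0 : x * y ≈ 0# → ¬ (y ≈ 0#) → x ≈ 0#
  xy≈0∧y≉0⇒x≈0 {x} {y} xy≈0 y≉0 = proj₁ (tight x 0#) λ x#0 →
    let u , ux≈1 = inverseˡ x#0 in y≉0 (begin
      y            ≈⟨ *-identityˡ y ⟨
      1# * y       ≈⟨ *-congʳ ux≈1 ⟨
      u * x * y    ≈⟨ *-assoc u x y ⟩
      u * (x * y)  ≈⟨ *-congˡ xy≈0 ⟩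
      u * 0#       ≈⟨ zeroʳ u ⟩
      0#           ∎)

  -- A positive product makes both factors apart from 0, so their signs are known; in the only
  -- surviving case `0# < x`, `y < 0#` the product is negative.
  0≤x∧y≤0⇒xy≤0 : 0# ≤ x → y ≤ 0# → x * y ≤ 0#
  0≤x∧y≤0⇒xy≤0 {x} {y} 0≤x y≤0 0<xy
    with #⇒<⊎> (*-#0ˡ {x} {y} (#-sym (<⇒# 0<xy))) | #⇒<⊎> (*-#0ʳ {x} {y} (#-sym (<⇒# 0<xy)))
  ... | inj₁ x<0 | _        = 0≤x x<0
  ... | inj₂ _   | inj₂ 0<y = y≤0 0<y
  ... | inj₂ 0<x | inj₁ y<0 = <-irrefl (sym xy-xy≈0) 0<xy-xy
    where
    xy-xy≈0 : x * y - x * y ≈ 0#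
    xy-xy≈0 = -‿inverseʳ (x * y)

    0<-xy : 0# < - (x * y)
    0<-xy = <-respʳ-≈ (sym (-‿distribʳ-* x y)) (*-pos 0<x (x<0⇒0<-x y<0))

    0<xy-xy : 0# < x * y - x * y
    0<xy-xy = <-trans 0<-xy (<-respˡ-≈ (+-identityˡ _) (+-monoˡ-< (- (x * y)) 0<xy))

  sum-mono-≤ : ∀ {k} {f g : Fin k → Carrier} → (∀ i → f i ≤ g i) → sum f ≤ sum g
  sum-mono-≤ {zero}  f≤g = ≤-reflexive refl
  sum-mono-≤ {suc k} f≤g = +-mono-≤ (f≤g zero) (sum-mono-≤ (f≤g ∘ suc))

  sum-≈0 : ∀ {k} {f : Fin k → Carrier} → (∀ i → f i ≈ 0#) → sum f ≈ 0#
  sum-≈0 {k} f≈0 = trans (sum-cong-≋ f≈0) (sum-replicate-zero k)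

  sum-≤0 : ∀ {k} {f : Fin k → Carrier} → (∀ i → f i ≤ 0#) → sum f ≤ 0#
  sum-≤0 {k} f≤0 = ≤-respʳ-≈ (sum-replicate-zero k) (sum-mono-≤ f≤0)

  nonpositive-sum≈0⇒≈0 : ∀ {k} {f : Fin k → Carrier} →
    (∀ i → f i ≤ 0#) → sum f ≈ 0# → ∀ i → f i ≈ 0#
  nonpositive-sum≈0⇒≈0 {suc k} {f} f≤0 ∑≈0 = λ where
      zero    → f₀≈0
      (suc i) → nonpositive-sum≈0⇒≈0 (f≤0 ∘ suc) tail≈0 i
    where
    f₀≈0 : f zero ≈ 0#
    f₀≈0 = ≤-antisym (f≤0 zero) (≤-respʳ-≈ (+-identityʳ (f zero))
      (≤-respˡ-≈ ∑≈0 (+-mono-≤ (≤-reflexive refl) (sum-≤0 (f≤0 ∘ suc)))))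

    tail≈0 : sum (f ∘ suc) ≈ 0#
    tail≈0 = trans (sym (+-identityˡ _)) (trans (+-congʳ (sym f₀≈0)) ∑≈0)

  sum-single : ∀ {k} {f : Fin k → Carrier} i → (∀ j → ¬ (i ≡ j) → f j ≈ 0#) → sum f ≈ f i
  sum-single {suc k} {f} zero    others = trans
    (+-congˡ (sum-≈0 (λ j → others (suc j) λ ()))) (+-identityʳ (f zero))
  sum-single {suc k} {f} (suc i) others = trans
    (+-cong (others zero λ ()) (sum-single i λ j i≢j → others (suc j) λ where ≡.refl → i≢j ≡.refl))
    (+-identityˡ (f (suc i)))

  fromNat-mono-≤ : ∀ {m n} → m ℕ.≤ n → fromNat m ≤ fromNat n
  fromNat-mono-≤ {n = zero}  ℕ.z≤n       = ≤-reflexive refl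
  fromNat-mono-≤ {n = suc n} ℕ.z≤n       = ≤-respˡ-≈ (+-identityʳ 0#)
    (+-mono-≤ (<⇒≤ 0<1) (fromNat-mono-≤ {n = n} ℕ.z≤n))
  fromNat-mono-≤ (ℕ.s≤s m≤n) = +-mono-≤ (≤-reflexive refl) (fromNat-mono-≤ m≤n)

  fromNat-mono-< : ∀ {m n} → m ℕ.< n → fromNat m < fromNat n
  fromNat-mono-< {m} {n} m<n with <-cotrans (x<x+1 (fromNat m)) (fromNat n)
  ... | inj₁ lt = lt
  ... | inj₂ lt = contradiction (<-respʳ-≈ (+-comm (fromNat m) 1#) lt) (fromNat-mono-≤ m<n)

  fromNat-suc-1 : ∀ n → fromNat (suc n) - 1# ≈ fromNat n
  fromNat-suc-1 n = trans (+-congʳ (+-comm 1# (fromNat n))) (x+y-y≈x (fromNat n) 1#)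

-- Linear independence and the dimension bound.

module LinearAlgebra {c ℓ₁ ℓ₂} (F : OrderedField c ℓ₁ ℓ₂) where
  open OrderedField F hiding (zero)
  open OrderedFieldProperties F
  open SetoidReasoning setoid

  LinearlyIndependent : ∀ {k} {J : Set} → (Fin k → J → Carrier) → Set (c ⊔ ℓ₁)
  LinearlyIndependent {k} v = ∀ (μ : Fin k → Carrier) →
    (∀ a → sum (λ i → μ i * v i a) ≈ 0#) → ∀ i → μ i ≈ 0#

  -- One step of Gaussian elimination with pivot v₀ r: column r is cleared and
  -- then dropped.
  eliminate : ∀ {k N} (v : Fin (suc k) → Fin (suc N) → Carrier) r →
    LinearlyIndependent v → v zero r # 0# →
    ∃[ w ] LinearlyIndependent {k} {Fin N} w
  eliminate {k} {N} v r independent v₀r#0 = (λ i → w i ∘ punchIn r) , w-independent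
    where
    pivot⁻¹ : Carrier
    pivot⁻¹ = proj₁ (inverseˡ v₀r#0)

    ratio : Fin k → Carrier
    ratio i = v (suc i) r * pivot⁻¹

    w : Fin k → Fin (suc N) → Carrier
    w i a = v (suc i) a - ratio i * v zero a

    w-cleared : ∀ i → w i r ≈ 0#
    w-cleared i = begin
      v (suc i) r - v (suc i) r * pivot⁻¹ * v zero r    ≈⟨ +-congˡ (-‿cong (*-assoc _ _ _)) ⟩
      v (suc i) r - v (suc i) r * (pivot⁻¹ * v zero r)  ≈⟨ +-congˡ (-‿cong (*-congˡ (proj₂ (inverseˡ v₀r#0)))) ⟩
      v (suc i) r - v (suc i) r * 1#                    ≈⟨ +-congˡ (-‿cong (*-identityʳ _)) ⟩
      v (suc i) r - v (suc i) r                         ≈⟨ -‿inverseʳ _ ⟩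
      0#                                                ∎

    module _ (ν : Fin k → Carrier)
             (νw≈0 : ∀ s → sum (λ i → ν i * w i (punchIn r s)) ≈ 0#) where

      νw≈0′ : ∀ a → sum (λ i → ν i * w i a) ≈ 0#
      νw≈0′ a with r Fin.≟ a
      ... | yes ≡.refl = sum-≈0 λ i → trans (*-congˡ (w-cleared i)) (zeroʳ (ν i))
      ... | no r≢a = ≡.subst (λ a → sum (λ i → ν i * w i a) ≈ 0#)
                       (Fin.punchIn-punchOut r≢a) (νw≈0 (punchOut r≢a))

      -- Expanding each `w i` turns a relation among the `w i` into one among the rows of `v`; this
      -- is the coefficient collected at the pivot row `v zero`.
      ν₀ : Carrier
      ν₀ = sum (λ i → - (ν i * ratio i))

      expand : ∀ a i → - (ν i * ratio i) * v zero a + ν i * v (suc i) a ≈ ν i * w i a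
      expand a i = begin
        - (ν i * ratio i) * v zero a + ν i * v (suc i) a    ≈⟨ +-comm _ _ ⟩
        ν i * v (suc i) a + - (ν i * ratio i) * v zero a    ≈⟨ +-congˡ (-‿distribˡ-* _ _) ⟨
        ν i * v (suc i) a - ν i * ratio i * v zero a        ≈⟨ +-congˡ (-‿cong (*-assoc _ _ _)) ⟩
        ν i * v (suc i) a - ν i * (ratio i * v zero a)      ≈⟨ +-congˡ (-‿distribʳ-* _ _) ⟩
        ν i * v (suc i) a + ν i * - (ratio i * v zero a)    ≈⟨ distribˡ _ _ _ ⟨
        ν i * w i a                                         ∎

      relation : ∀ a → ν₀ * v zero a + sum (λ i → ν i * v (suc i) a) ≈ 0#
      relation a = begin
        ν₀ * v zero a + sum (λ i → ν i * v (suc i) a)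
          ≈⟨ +-congʳ (*-distribʳ-sum (v zero a) (λ i → - (ν i * ratio i))) ⟩
        sum (λ i → - (ν i * ratio i) * v zero a) + sum (λ i → ν i * v (suc i) a)
          ≈⟨ ∑-distrib-+ (λ i → - (ν i * ratio i) * v zero a) (λ i → ν i * v (suc i) a) ⟨
        sum (λ i → - (ν i * ratio i) * v zero a + ν i * v (suc i) a)
          ≈⟨ sum-cong-≋ (expand a) ⟩
        sum (λ i → ν i * w i a)
          ≈⟨ νw≈0′ a ⟩
        0#
          ∎

      w-independent : ∀ i → ν i ≈ 0#
      w-independent i = independent (ν₀ ∷ ν) relation (suc i)

  -- Being nonzero is not decidable, but _≤_ on ℕ is stable, so a pivot may be
  -- searched for classically.
  linearlyIndependent⇒≤ : ∀ {k N} (v : Fin k → Fin N → Carrier) →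
    LinearlyIndependent v → k ℕ.≤ N
  linearlyIndependent⇒≤ {zero}      v independent = ℕ.z≤n
  linearlyIndependent⇒≤ {suc k} {N} v independent =
    decidable-stable (suc k ℕ.≤? N) λ k≰N →
      -- Without a pivot `v zero` is the zero vector, so the coefficients 1, 0, ..., 0 form a
      -- nontrivial relation.
      1≉0 (independent (1# ∷ λ _ → 0#) (λ a → begin
          1# * v zero a + sum (λ i → 0# * v (suc i) a)
            ≈⟨ +-cong (trans (*-identityˡ _) (v₀≈0 k≰N a)) (sum-≈0 λ i → zeroˡ (v (suc i) a)) ⟩
          0# + 0#
            ≈⟨ +-identityʳ 0# ⟩
          0#
            ∎) zero)
    where
    bound-from-pivot : ∀ {N} (v : Fin (suc k) → Fin N → Carrier) → LinearlyIndependent v →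
      ∀ r → v zero r # 0# → suc k ℕ.≤ N
    bound-from-pivot {suc N} v independent r v₀r#0 =
      let w , w-independent = eliminate v r independent v₀r#0
      in ℕ.s≤s (linearlyIndependent⇒≤ w w-independent)

    v₀≈0 : ¬ (suc k ℕ.≤ N) → ∀ r → v zero r ≈ 0#
    v₀≈0 k≰N r = proj₁ (tight _ _) (k≰N ∘ bound-from-pivot v independent r)

-- Convex hulls, affine independence and facet criteria.

module PolyhedralProperties {c ℓ₁ ℓ₂} (ℝ : RealNumbers c ℓ₁ ℓ₂) {I : Set} where
  open RealNumbers ℝ hiding (zero)
  open Polyhedral ℝ {I}
  open OrderedFieldProperties orderedField
  open LinearAlgebra orderedField
  open SetoidReasoning setoid

  -- Linearity as preservation of finite linear combinations. Taking `x` only up to coordinatewise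
  -- equality builds in congruence, and `k = 0` covers the zero vector.
  IsLinear : (Point → Carrier) → Set (c ⊔ ℓ₁)
  IsLinear g = ∀ {k} (μ : Fin k → Carrier) (y : Fin k → Point) x →
    (∀ a → x a ≈ sum (λ i → μ i * y i a)) → g x ≈ sum (λ i → μ i * g (y i))

  coordinate-isLinear : ∀ a → IsLinear (λ x → x a)
  coordinate-isLinear a μ y x x≈∑ = x≈∑ a

  ⊆-conv : ∀ {ℓ} (S : Pred Point ℓ) x → x ∈ S → x ∈ conv S
  ⊆-conv S x x∈S =
    1 , (λ _ → x) , (λ _ → 1#) , (λ _ → x∈S) , (λ _ → <⇒≤ 0<1) , +-identityʳ 1# ,
    λ a → sym (trans (+-identityʳ (1# * x a)) (*-identityˡ (x a)))

  module _ {ℓ} (S : Pred Point ℓ) {f : Point → Carrier} (f-linear : IsLinear f)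
           (f≤0 : ∀ x → x ∈ S → f x ≤ 0#) where

    conv-valid : Valid (conv S) f 0#
    conv-valid x (k , y , μ , y∈S , 0≤μ , _ , x≈∑) =
      ≤-respˡ-≈ (sym (f-linear μ y x x≈∑))
        (sum-≤0 λ i → 0≤x∧y≤0⇒xy≤0 (0≤μ i) (f≤0 (y i) (y∈S i)))

    -- In a convex combination on the face, the products `μ i * f (y i)` are nonpositive with sum 0,
    -- so each vanishes. The alternative in the hypothesis then annihilates `μ i * g (y i)` without
    -- deciding whether `μ i` is zero.
    conv-face-vanishing : ∀ {g} → IsLinear g →
      (∀ x → x ∈ S → g x ≈ 0# ⊎ ¬ (f x ≈ 0#)) →
      ∀ x → x ∈ Face (conv S) f 0# → g x ≈ 0#
    conv-face-vanishing {g} g-linear vanishing x ((k , y , μ , y∈S , 0≤μ , _ , x≈∑) , fx≈0) =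
      trans (g-linear μ y x x≈∑) (sum-≈0 μg≈0)
      where
      μf≈0 : ∀ i → μ i * f (y i) ≈ 0#
      μf≈0 = nonpositive-sum≈0⇒≈0 (λ i → 0≤x∧y≤0⇒xy≤0 (0≤μ i) (f≤0 (y i) (y∈S i)))
        (trans (sym (f-linear μ y x x≈∑)) fx≈0)

      μg≈0 : ∀ i → μ i * g (y i) ≈ 0#
      μg≈0 i with vanishing (y i) (y∈S i)
      ... | inj₁ g≈0 = trans (*-congˡ g≈0) (zeroʳ (μ i))
      ... | inj₂ f≉0 = trans (*-congʳ (xy≈0∧y≉0⇒x≈0 (μf≈0 i) f≉0)) (zeroˡ (g (y i)))

  -- Applying `g` to an affine relation removes the terms of `y` and leaves `μ zero * g u ≈ 0#`, so
  -- `u` drops out of the relation.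
  affinelyIndependent-∷ : ∀ {k g u} {y : Fin k → Point} → IsLinear g →
    (∀ i → g (y i) ≈ 0#) → ¬ (g u ≈ 0#) →
    AffinelyIndependent y → AffinelyIndependent (u ∷ y)
  affinelyIndependent-∷ {k} {g} {u} {y} g-linear gy≈0 gu≉0 independent μ ∑μ≈0 ∑μy≈0 = λ where
      zero    → μ₀≈0
      (suc i) → independent (μ ∘ suc) (drop-zero μ₀≈0 ∑μ≈0)
                  (λ a → drop-zero (trans (*-congʳ μ₀≈0) (zeroˡ (u a))) (∑μy≈0 a)) i
    where
    drop-zero : ∀ {x y} → x ≈ 0# → x + y ≈ 0# → y ≈ 0#
    drop-zero {x} {y} x≈0 x+y≈0 = trans (sym (+-identityˡ y)) (trans (+-congʳ (sym x≈0)) x+y≈0)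

    g-combination : μ zero * g u ≈ 0#
    g-combination = begin
      μ zero * g u
        ≈⟨ +-identityʳ _ ⟨
      μ zero * g u + 0#
        ≈⟨ +-congˡ (sum-≈0 λ i → trans (*-congˡ (gy≈0 i)) (zeroʳ (μ (suc i)))) ⟨
      μ zero * g u + sum (λ i → μ (suc i) * g (y i))
        ≈⟨ g-linear μ (u ∷ y) (λ _ → 0#) (λ a → sym (∑μy≈0 a)) ⟨
      g (λ _ → 0#)
        ≈⟨ g-linear {0} (λ ()) (λ ()) (λ _ → 0#) (λ _ → refl) ⟩
      0#
        ∎

    μ₀≈0 : μ zero ≈ 0#
    μ₀≈0 = xy≈0∧y≉0⇒x≈0 g-combination gu≉0

  -- Homogenisation: prefixing a coordinate 1 turns affine independence into linear independence in
  -- a space with one more coordinate.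
  affinelyIndependent⇒≤ : ∀ {N} (e : Fin N → I) → (∀ a → ∃[ j ] e j ≡ a) →
    ∀ {k} (y : Fin k → Point) → AffinelyIndependent y → k ℕ.≤ suc N
  affinelyIndependent⇒≤ {N} e e-surjective {k} y independent =
    linearlyIndependent⇒≤ lift λ μ relations → independent μ
      (trans (sum-cong-≋ (λ i → sym (*-identityʳ (μ i)))) (relations zero))
      (λ a → let j , ej≡a = e-surjective a in
        ≡.subst (λ a → sum (λ i → μ i * y i a) ≈ 0#) ej≡a (relations (suc j)))
    where
    lift : Fin k → Fin (suc N) → Carrier
    lift i = 1# ∷ (y i ∘ e)

  module _ {ℓ} {P : Pred Point ℓ} {f : Point → Carrier} (f-linear : IsLinear f) where

    -- The point `u` off the hyperplane `f = 0` extends every affinely independent family in the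
    -- face by one. With `y` this shows that `P` has dimension `r`, and for arbitrary families it
    -- bounds those in the face by `r` points.
    definesFacet : ∀ {r} → Valid P f 0# → ∀ u → u ∈ P → ¬ (f u ≈ 0#) →
      (∀ {k} (y : Fin k → Point) → AffinelyIndependent y → k ℕ.≤ suc r) →
      (y : Fin r → Point) → (∀ i → y i ∈ Face P f 0#) → AffinelyIndependent y →
      DefinesFacet P f 0#
    definesFacet {r} valid u u∈P fu≉0 bound y y∈face independent =
      valid , + suc r -ℤ 1ℤ ,
      (suc r , ≡.refl ,
        (u ∷ y , (λ { zero → u∈P ; (suc i) → proj₁ (y∈face i) }) ,
          affinelyIndependent-∷ f-linear (proj₂ ∘ y∈face) fu≉0 independent) ,
        λ k y _ → bound y) ,
      (r , ≡.refl , (y , y∈face , independent) ,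
        λ k x x∈face x-independent → ℕ.s≤s⁻¹
          (bound (u ∷ x) (affinelyIndependent-∷ f-linear (proj₂ ∘ x∈face) fu≉0 x-independent)))

    -- The face lies in the hyperplane g = 0, which neither contains P nor
    -- agrees on P with f = 0, so it misses at least two dimensions of P.
    ¬definesFacet : ∀ {g} → IsLinear g → (∀ x → x ∈ Face P f 0# → g x ≈ 0#) →
      ∀ u → u ∈ P → ¬ (f u ≈ 0#) → g u ≈ 0# → ∀ v → v ∈ P → ¬ (g v ≈ 0#) → ¬ DefinesFacet P f 0#
    ¬definesFacet {g} g-linear g≈0 u u∈P fu≉0 gu≈0 v v∈P gv≉0
      (_ , d , (r , d≡r-1 , _ , bound) , (r′ , d-1≡r′-1 , (y , y∈face , independent) , _)) =
      ℕ.n≮n (suc r′) (≡.subst (suc (suc r′) ℕ.≤_) r≡1+r′ (bound _ (v ∷ u ∷ y) ∈P vuy-independent))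
      where
      ∈P : ∀ i → (v ∷ u ∷ y) i ∈ P
      ∈P zero          = v∈P
      ∈P (suc zero)    = u∈P
      ∈P (suc (suc i)) = proj₁ (y∈face i)

      g-vanishes : ∀ i → g ((u ∷ y) i) ≈ 0#
      g-vanishes zero    = gu≈0
      g-vanishes (suc i) = g≈0 (y i) (y∈face i)

      vuy-independent : AffinelyIndependent (v ∷ u ∷ y)
      vuy-independent = affinelyIndependent-∷ g-linear g-vanishes gv≉0
        (affinelyIndependent-∷ f-linear (proj₂ ∘ y∈face) fu≉0 independent)

      r≡1+r′ : r ≡ suc r′
      r≡1+r′ = ℤ.+-injective (-1-injective (≡.trans (≡.sym d≡r-1) (-1-injective d-1≡r′-1)))
        where
        -1-injective : ∀ {i j} → i -ℤ 1ℤ ≡ j -ℤ 1ℤ → i ≡ j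
        -1-injective = ∙-cancelʳ -1ℤ _ _

-- Auxiliary facts on lists and increasing sequences.

lookup-injective : ∀ {a} {A : Set a} {xs : List A} → Unique xs → Injective _≡_ _≡_ (List.lookup xs)
lookup-injective (x∉xs AllPairs.∷ u) {zero}  {zero}  eq = ≡.refl
lookup-injective (x∉xs AllPairs.∷ u) {zero}  {suc j} eq = contradiction eq (All.lookup x∉xs (∈-lookup j))
lookup-injective (x∉xs AllPairs.∷ u) {suc i} {zero}  eq = contradiction (≡.sym eq) (All.lookup x∉xs (∈-lookup i))
lookup-injective (x∉xs AllPairs.∷ u) {suc i} {suc j} eq = ≡.cong suc (lookup-injective u eq)

increasing⇒≤ : ∀ {k} (f : Fin (suc k) → ℕ) → (∀ i → f (inject₁ i) ℕ.< f (suc i)) →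
  f zero ℕ.≤ f (fromℕ k)
increasing⇒≤ {zero}  f f-inc = ℕ.≤-refl
increasing⇒≤ {suc k} f f-inc =
  ℕ.≤-trans (ℕ.<⇒≤ (f-inc zero)) (increasing⇒≤ (f ∘ suc) (f-inc ∘ suc))

-- Arcs, rotations of closed paths, and acyclicity.

module GraphProperties {n : ℕ} (G : SimpleGraph n) where
  open SimpleGraph G
  open Arc using (src; tgt)

  adjacent : (a : Arc G) → src a ~ tgt a
  adjacent (arc i j i~j) = recompute (i ~? j) i~j

  arc-≡ : ∀ {a b : Arc G} → src a ≡ src b → tgt a ≡ tgt b → a ≡ b
  arc-≡ ≡.refl ≡.refl = ≡.refl

  _≟_ : DecidableEquality (Arc G)
  a ≟ b = map′ (λ (s , t) → arc-≡ s t) (λ a≡b → ≡.cong src a≡b , ≡.cong tgt a≡b)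
    (src a Fin.≟ src b ×-dec tgt a Fin.≟ tgt b)

  arcsBetween : Fin n → Fin n → List (Arc G)
  arcsBetween i j with i ~? j
  ... | yes i~j = List.[ arc i j i~j ]
  ... | no _    = List.[]

  ∈-arcsBetween : ∀ a → a ∈ˡ arcsBetween (src a) (tgt a)
  ∈-arcsBetween a with src a ~? tgt a
  ... | yes _ = here ≡.refl
  ... | no ¬e = contradiction (adjacent a) ¬e

  allArcs : List (Arc G)
  allArcs = deduplicate _≟_ (concatMap (λ i → concatMap (arcsBetween i) (allFin n)) (allFin n))

  allArcs-unique : Unique allArcs
  allArcs-unique = UniqueDec.deduplicate-! _≟_ _

  ∈-allArcs : ∀ a → a ∈ˡ allArcs
  ∈-allArcs a = ∈-deduplicate⁺ _≟_ (∈-concatMap⁺ _ (lose (∈-allFin (src a))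
    (∈-concatMap⁺ _ (lose (∈-allFin (tgt a)) (∈-arcsBetween a)))))

  arcCount : ℕ
  arcCount = List.length allArcs

  enumerate : Fin arcCount → Arc G
  enumerate = List.lookup allArcs

  enumerate-injective : Injective _≡_ _≡_ enumerate
  enumerate-injective = lookup-injective allArcs-unique

  enumerate-surjective : ∀ a → ∃[ j ] enumerate j ≡ a
  enumerate-surjective a = Any.index (∈-allArcs a) , ≡.sym (lookup-index (∈-allArcs a))

  module _ {k} (q : Path G k) where
    open Path q

    arcs-injective-src : ∀ {i j} → src (arcs i) ≡ src (arcs j) → i ≡ j
    arcs-injective-src = Fin.inject₁-injective ∘ elementary

    arcs-injective-tgt : ∀ {i j} → tgt (arcs i) ≡ tgt (arcs j) → i ≡ j
    arcs-injective-tgt = Fin.suc-injective ∘ elementary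

  -- The closing arc of the cycle becomes the first arc of the path, and the last arc of `q` is cut
  -- away to become the new closing arc.
  rotate : ∀ {k} (q : Path G (suc k)) → Path.sink q ~ Path.source q → Path G (suc k)
  rotate {k} q closing = record
    { vertex     = rotated
    ; elementary = rotated-injective
    ; linked     = λ where
        zero    → closing
        (suc i) → linked (inject₁ i)
    }
    where
    open Path q

    rotated : Fin (suc (suc k)) → Fin n
    rotated = sink ∷ (vertex ∘ inject₁)

    rotated-injective : Injective _≡_ _≡_ rotated
    rotated-injective {zero}  {zero}  eq = ≡.refl
    rotated-injective {zero}  {suc j} eq = contradiction (elementary eq) Fin.fromℕ≢inject₁
    rotated-injective {suc i} {zero}  eq = contradiction (elementary (≡.sym eq)) Fin.fromℕ≢inject₁
    rotated-injective {suc i} {suc j} eq = ≡.cong suc (Fin.inject₁-injective (elementary eq))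

  rotate-closing : ∀ {k} (q : Path G (suc k)) (closing : Path.sink q ~ Path.source q) →
    Path.sink (rotate q closing) ~ Path.source (rotate q closing)
  rotate-closing {k} q closing = Path.linked q (fromℕ k)

  -- A rank increasing along the arcs of S certifies that S is acyclic.
  Ranks : Pred (Arc G) 0ℓ → (Fin n → ℕ) → Set
  Ranks S rank = ∀ a → S a → rank (src a) ℕ.< rank (tgt a)

  -- If all arcs of `C` were in `S`, the rank would not decrease from source to sink along the path,
  -- yet the closing arc would raise it strictly from sink back to source. Decidability makes the
  -- missing arc explicit.
  ranks⇒acyclic : ∀ {S} → Decidable S → ∀ {rank} → Ranks S rank →
    ∀ C → ∃[ i ] ¬ S (Cycle.arcs C i)
  ranks⇒acyclic {S} S? {rank} ranks C =
    Fin.¬∀⟶∃¬ _ (λ i → S (Cycle.arcs C i)) (λ i → S? (Cycle.arcs C i)) λ all →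
      ℕ.<⇒≱ (ranks _ (all zero))
        (increasing⇒≤ (rank ∘ Path.vertex (Cycle.path C)) (λ i → ranks _ (all (suc i))))

  ranks⇒asymmetric : ∀ {S rank} → Ranks S rank → ∀ a → S a → ¬ S (reverse G a)
  ranks⇒asymmetric ranks a Sa Sra = ℕ.<-asym (ranks a Sa) (ranks (reverse G a) Sra)

  -- Rankings for stars: when all arcs leave `u`, it suffices to put `u` below every other vertex;
  -- when all enter `u`, above.
  sourceRank sinkRank : Fin n → Fin n → ℕ
  sourceRank u v with u Fin.≟ v
  ... | yes _ = 0
  ... | no  _ = 1
  sinkRank u v with u Fin.≟ v
  ... | yes _ = 1
  ... | no  _ = 0

  src≢tgt : (a : Arc G) → ¬ (src a ≡ tgt a)
  src≢tgt a eq = ~-irrefl eq (adjacent a)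

  sourceRank-ranks : ∀ {S u} → (∀ a → S a → src a ≡ u) → Ranks S (sourceRank u)
  sourceRank-ranks {S} {u} srcs a Sa with srcs a Sa
  ... | ≡.refl with src a Fin.≟ src a | src a Fin.≟ tgt a
  ...   | _      | yes eq = contradiction eq (src≢tgt a)
  ...   | no s≢s | _      = contradiction ≡.refl s≢s
  ...   | yes _  | no _   = ℕ.s≤s ℕ.z≤n

  sinkRank-ranks : ∀ {S u} → (∀ a → S a → tgt a ≡ u) → Ranks S (sinkRank u)
  sinkRank-ranks {S} {u} tgts a Sa with tgts a Sa
  ... | ≡.refl with tgt a Fin.≟ tgt a | tgt a Fin.≟ src a
  ...   | _      | yes eq = contradiction (≡.sym eq) (src≢tgt a)
  ...   | no t≢t | _      = contradiction ≡.refl t≢t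
  ...   | yes _  | no _   = ℕ.s≤s ℕ.z≤n

  -- Adding one arc to a path.

  module _ {k} (p : Path G k) where
    open Path p

    OnPath : Pred (Arc G) 0ℓ
    OnPath a = ∃[ i ] arcs i ≡ a

    onPath? : Decidable OnPath
    onPath? a = Fin.any? (λ i → arcs i ≟ a)

    -- `Leaves` holds exactly at the vertices of `p` other than the sink, `Enters` at those other
    -- than the source.
    Leaves Enters : Pred (Fin n) 0ℓ
    Leaves v = ∃[ i ] src (arcs i) ≡ v
    Enters v = ∃[ i ] tgt (arcs i) ≡ v

    -- Meant as a topological order for `p` together with `a`: the vertices of `p` take the ranks 1
    -- to `k + 1`, a tail of `a` off `p` goes below them, and all other vertices go above.
    extensionRank : Arc G → Fin n → ℕ
    extensionRank a v with Fin.any? (λ i → vertex i Fin.≟ v)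
    ... | yes (i , _) = suc (toℕ i)
    ... | no _ with src a Fin.≟ v
    ...   | yes _ = 0
    ...   | no _  = 2 ℕ.+ k

    extensionRank-vertex : ∀ a i → extensionRank a (vertex i) ≡ suc (toℕ i)
    extensionRank-vertex a i with Fin.any? (λ j → vertex j Fin.≟ vertex i)
    ... | yes (j , eq) = ≡.cong (suc ∘ toℕ) (elementary eq)
    ... | no ∄i = contradiction (i , ≡.refl) ∄i

    extensionRank-onPath : ∀ a {b} → OnPath b →
      extensionRank a (src b) ℕ.< extensionRank a (tgt b)
    extensionRank-onPath a (i , ≡.refl)
      rewrite extensionRank-vertex a (inject₁ i) | extensionRank-vertex a (suc i)
            | Fin.toℕ-inject₁ i = ℕ.≤-refl

    -- With both ends of `a` on `p`, the two negations force `a` to run from sink to source, which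
    -- nonadjacency forbids. Otherwise, a tail on `p` has rank at most `k + 1`, below a head off
    -- `p`, and a tail off `p` has rank 0, below any head.
    extensionRank-new : ¬ (source ~ sink) → ∀ {a} → ¬ Leaves (src a) → ¬ Enters (tgt a) →
      extensionRank a (src a) ℕ.< extensionRank a (tgt a)
    extensionRank-new ¬s~t {a} ¬leaves ¬enters
      with Fin.any? (λ i → vertex i Fin.≟ src a) | Fin.any? (λ i → vertex i Fin.≟ tgt a)
    ... | yes (i , eqᵢ) | yes (j , eqⱼ) = contradiction (ends i j eqᵢ eqⱼ) ¬s~t
      where
      ends : ∀ i j → vertex i ≡ src a → vertex j ≡ tgt a → source ~ sink
      ends i (suc j) eqᵢ eqⱼ = contradiction (j , eqⱼ) ¬enters
      ends i zero    eqᵢ eqⱼ with view i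
      ... | ‵inject₁ i = contradiction (i , eqᵢ) ¬leaves
      ... | ‵fromℕ     = ~-sym (≡.subst₂ _~_ (≡.sym eqᵢ) (≡.sym eqⱼ) (adjacent a))
    ... | yes (i , _) | no _ with src a Fin.≟ tgt a
    ...   | yes eq = contradiction eq (src≢tgt a)
    ...   | no _   = ℕ.s≤s (Fin.toℕ<n i)
    extensionRank-new ¬s~t {a} ¬leaves ¬enters
        | no _ | q with src a Fin.≟ src a
    ...   | no s≢s = contradiction ≡.refl s≢s
    ...   | yes _ with q
    ...     | yes _ = ℕ.s≤s ℕ.z≤n
    ...     | no _ with src a Fin.≟ tgt a
    ...       | yes eq = contradiction eq (src≢tgt a)
    ...       | no _   = ℕ.s≤s ℕ.z≤n

-- Closure properties of linear forms.

module LinearForms {c ℓ₁ ℓ₂} (ℝ : RealNumbers c ℓ₁ ℓ₂) {I : Set} where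
  open RealNumbers ℝ hiding (zero)
  open Polyhedral ℝ {I}
  open OrderedFieldProperties orderedField
  open PolyhedralProperties ℝ {I}
  open SetoidReasoning setoid

  +-isLinear : ∀ {g h} → IsLinear g → IsLinear h → IsLinear (λ x → g x + h x)
  +-isLinear {g} {h} g-linear h-linear μ y x x≈∑ = begin
    g x + h x
      ≈⟨ +-cong (g-linear μ y x x≈∑) (h-linear μ y x x≈∑) ⟩
    sum (λ i → μ i * g (y i)) + sum (λ i → μ i * h (y i))
      ≈⟨ ∑-distrib-+ (λ i → μ i * g (y i)) (λ i → μ i * h (y i)) ⟨
    sum (λ i → μ i * g (y i) + μ i * h (y i))
      ≈⟨ sum-cong-≋ (λ i → distribˡ (μ i) (g (y i)) (h (y i))) ⟨
    sum (λ i → μ i * (g (y i) + h (y i)))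
      ∎

  -‿isLinear : ∀ {g} → IsLinear g → IsLinear (λ x → - g x)
  -‿isLinear {g} g-linear μ y x x≈∑ = begin
    - g x                                 ≈⟨ -‿cong (g-linear μ y x x≈∑) ⟩
    - sum (λ i → μ i * g (y i))           ≈⟨ -1*x≈-x _ ⟨
    - 1# * sum (λ i → μ i * g (y i))      ≈⟨ *-distribˡ-sum (- 1#) (λ i → μ i * g (y i)) ⟩
    sum (λ i → - 1# * (μ i * g (y i)))    ≈⟨ sum-cong-≋ (λ i →
                                              trans (-1*x≈-x _) (-‿distribʳ-* (μ i) (g (y i)))) ⟩
    sum (λ i → μ i * - g (y i))           ∎

  sum-isLinear : ∀ {m} {g : Fin m → Point → Carrier} → (∀ j → IsLinear (g j)) →
    IsLinear (λ x → sum (λ j → g j x))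
  sum-isLinear {zero}  g-linear μ y x x≈∑ = sym (sum-≈0 (λ i → zeroʳ (μ i)))
  sum-isLinear {suc m} g-linear =
    +-isLinear (g-linear zero) (sum-isLinear (g-linear ∘ suc))

-- Sums of values between 0 and 1, and indicators.

module BinarySums {c ℓ₁ ℓ₂} (F : OrderedField c ℓ₁ ℓ₂) where
  open OrderedField F hiding (zero)
  open OrderedFieldProperties F
  open SetoidReasoning setoid

  sum-≈1 : ∀ {k} {f : Fin k → Carrier} → (∀ i → f i ≈ 1#) → sum f ≈ fromNat k
  sum-≈1 {k} f≈1 = trans (sum-cong-≋ f≈1) (sum-replicate k)

  sum-≤1 : ∀ {k} {f : Fin k → Carrier} → (∀ i → f i ≤ 1#) → sum f ≤ fromNat k
  sum-≤1 {k} f≤1 = ≤-respʳ-≈ (sum-replicate k) (sum-mono-≤ f≤1)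

  sum-missing : ∀ {k} {f : Fin k → Carrier} → (∀ i → f i ≤ 1#) → ∀ i → f i ≈ 0# →
    sum f ≤ fromNat k - 1#
  sum-missing {suc k} {f} f≤1 i fi≈0 =
    ≤-respˡ-≈ (sym (begin
      sum f                     ≈⟨ sum-remove {i = i} f ⟩
      f i + sum (removeAt f i)  ≈⟨ +-congʳ fi≈0 ⟩
      0# + sum (removeAt f i)   ≈⟨ +-identityˡ _ ⟩
      sum (removeAt f i)        ∎))
      (≤-respʳ-≈ (sym (fromNat-suc-1 k)) (sum-≤1 (f≤1 ∘ punchIn i)))

  indicator : ∀ {a} {A : Set a} → Dec A → Carrier
  indicator (yes _) = 1#
  indicator (no _)  = 0#

  indicator-binary : ∀ {a} {A : Set a} (A? : Dec A) → indicator A? ≈ 0# ⊎ indicator A? ≈ 1#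
  indicator-binary (yes _) = inj₂ refl
  indicator-binary (no _)  = inj₁ refl

  indicator-yes : ∀ {a} {A : Set a} (A? : Dec A) → A → indicator A? ≈ 1#
  indicator-yes (yes _) x = refl
  indicator-yes (no ¬x) x = contradiction x ¬x

  indicator-no : ∀ {a} {A : Set a} (A? : Dec A) → ¬ A → indicator A? ≈ 0#
  indicator-no (yes x) ¬x = contradiction x ¬x
  indicator-no (no _)  ¬x = refl

  indicator-≤1 : ∀ {a} {A : Set a} (A? : Dec A) → indicator A? ≤ 1#
  indicator-≤1 (yes _) = ≤-reflexive refl
  indicator-≤1 (no _)  = <⇒≤ 0<1

  module _ {k p} {P : Pred (Fin k) p} (P? : Decidable P) (unique : ∀ {i j} → P i → P j → i ≡ j) where

    sum-unique : ∃[ i ] P i → sum (indicator ∘ P?) ≈ 1#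
    sum-unique (i , Pi) = trans
      (sum-single i (λ j i≢j → indicator-no (P? j) (i≢j ∘ unique Pi)))
      (indicator-yes (P? i) Pi)

    sum-unique-≤1 : sum (indicator ∘ P?) ≤ 1#
    sum-unique-≤1 with Fin.any? P?
    ... | yes ∃P = ≤-reflexive (sum-unique ∃P)
    ... | no ∄P  = ≤-respˡ-≈ (sym (sum-≈0 λ i → indicator-no (P? i) (λ Pi → ∄P (i , Pi)))) (<⇒≤ 0<1)

-- Points on the face, and the facet in the nonadjacent case.

module PathFacet {c ℓ₁ ℓ₂} (ℝ : RealNumbers c ℓ₁ ℓ₂) {n} (G : SimpleGraph n) {κ} (p : Path G κ) where
  open RealNumbers ℝ hiding (zero)
  open Polyhedral ℝ {Coordinate ℝ G}
  open OrderedFieldProperties orderedField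
  open PolyhedralProperties ℝ {Coordinate ℝ G}
  open LinearForms ℝ {Coordinate ℝ G}
  open BinarySums orderedField
  open SimpleGraph G
  open GraphProperties G
  open Arc using (src; tgt)
  open SetoidReasoning setoid

  slack : Point → Carrier
  slack x = pathSum ℝ G p (wᶜ ℝ G x) - zᶜ ℝ G x

  slack-isLinear : IsLinear slack
  slack-isLinear = +-isLinear (sum-isLinear (λ i → coordinate-isLinear (inj₁ (Path.arcs p i))))
    (-‿isLinear (coordinate-isLinear (inj₂ tt)))

  slack≤0 : ∀ x → Feasible ℝ G κ x → slack x ≤ 0#
  slack≤0 x feasible = x≤y⇒x-y≤0 (Feasible.path≤z feasible p)

  polytope-valid : Valid (Polytope ℝ G κ) slack 0#
  polytope-valid = conv-valid (Feasible ℝ G κ) slack-isLinear slack≤0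

  -- The incidence vector of `S`, completed by the value `z`.
  point : ∀ {S : Pred (Arc G) 0ℓ} → Decidable S → Carrier → Point
  point S? z (inj₁ a) = indicator (S? a)
  point S? z (inj₂ _) = z

  point-feasible : ∀ {S rank z} (S? : Decidable S) → Ranks S rank → 0# ≤ z → z ≤ fromNat κ →
    (∀ q → pathSum ℝ G q (wᶜ ℝ G (point S? z)) ≤ z) → Feasible ℝ G κ (point S? z)
  point-feasible {S} S? ranks 0≤z z≤κ path≤z = record
    { edge≤1 = edge≤1
    ; cycle≤ = λ C → let i , ¬Si = ranks⇒acyclic S? ranks C in
        sum-missing (λ j → indicator-≤1 (S? (Cycle.arcs C j))) i
          (indicator-no (S? (Cycle.arcs C i)) ¬Si)
    ; path≤z = path≤z
    ; binary = indicator-binary ∘ S?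
    ; 0≤z    = 0≤z
    ; z≤κ    = z≤κ
    }
    where
    edge≤1 : ∀ a → indicator (S? a) + indicator (S? (reverse G a)) ≤ 1#
    edge≤1 a with S? a
    ... | no _   = ≤-respˡ-≈ (sym (+-identityˡ _)) (indicator-≤1 (S? (reverse G a)))
    ... | yes Sa = ≤-reflexive (trans
      (+-congˡ (indicator-no (S? (reverse G a)) (ranks⇒asymmetric ranks a Sa))) (+-identityʳ 1#))

  pathSum≤κ : ∀ {S : Pred (Arc G) 0ℓ} (S? : Decidable S) (q : Path G κ) →
    pathSum ℝ G q (indicator ∘ S?) ≤ fromNat κ
  pathSum≤κ S? q = sum-≤1 (λ i → indicator-≤1 (S? (Path.arcs q i)))

  point-κ-feasible : ∀ {S rank} (S? : Decidable S) → Ranks S rank →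
    Feasible ℝ G κ (point S? (fromNat κ))
  point-κ-feasible S? ranks = point-feasible S? ranks (fromNat-mono-≤ {0} {κ} ℕ.z≤n)
    (≤-reflexive refl) (pathSum≤κ S?)

  apex origin : Point
  apex   = point ∅? (fromNat κ)
  origin = point ∅? 0#

  ∅-ranks : Ranks ∅ (λ _ → 0)
  ∅-ranks _ ()

  pathSum-∅ : ∀ (q : Path G κ) → pathSum ℝ G q (indicator ∘ ∅?) ≈ 0#
  pathSum-∅ q = sum-≈0 {κ} (λ _ → refl)

  apex∈polytope : apex ∈ Polytope ℝ G κ
  apex∈polytope = ⊆-conv (Feasible ℝ G κ) apex (point-κ-feasible ∅? ∅-ranks)

  slack-apex : .{{NonZero κ}} → ¬ (slack apex ≈ 0#)
  slack-apex slack≈0 = <-irrefl 0≈κ (fromNat-mono-< {0} {κ} (ℕ.>-nonZero⁻¹ κ))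
    where
    0≈κ : 0# ≈ fromNat κ
    0≈κ = begin
      0#                                    ≈⟨ pathSum-∅ p ⟨
      pathSum ℝ G p (wᶜ ℝ G apex)           ≈⟨ x-y+y≈x _ (fromNat κ) ⟨
      slack apex + fromNat κ                ≈⟨ +-congʳ slack≈0 ⟩
      0# + fromNat κ                        ≈⟨ +-identityˡ (fromNat κ) ⟩
      fromNat κ                             ∎

  Tight : Pred Point _
  Tight x = Feasible ℝ G κ x × slack x ≈ 0#

  tight⇒face : ∀ {x} → Tight x → x ∈ Face (Polytope ℝ G κ) slack 0#
  tight⇒face {x} (feasible , slack≈0) = ⊆-conv (Feasible ℝ G κ) x feasible , slack≈0

  origin-tight : Tight origin
  origin-tight =
    point-feasible ∅? ∅-ranks (≤-reflexive refl) (fromNat-mono-≤ {0} {κ} ℕ.z≤n)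
      (λ q → ≤-reflexive (pathSum-∅ q)) ,
    trans (+-congʳ (pathSum-∅ p)) (-‿inverseʳ 0#)

  module _ .{{_ : NonZero κ}} {S : Pred (Arc G) 0ℓ} (S? : Decidable S) where

    -- Every path of length `κ` contains at most one arc of `S`, so `z = 1` is large enough; `p`
    -- contains exactly one, so the bound is attained. Positivity of `κ` gives `z ≤ κ`.
    conflicting⇒tight : ∀ {rank} → Ranks S rank →
      (∀ (q : Path G κ) {i j} → S (Path.arcs q i) → S (Path.arcs q j) → i ≡ j) →
      ∃[ i ] S (Path.arcs p i) → Tight (point S? 1#)
    conflicting⇒tight ranks conflicting meets =
      point-feasible S? ranks (<⇒≤ 0<1)
        (≤-respˡ-≈ (+-identityʳ 1#) (fromNat-mono-≤ {1} {κ} (ℕ.>-nonZero⁻¹ κ)))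
        (λ q → sum-unique-≤1 (S? ∘ Path.arcs q) (conflicting q)) ,
      trans (+-congʳ (sum-unique (S? ∘ Path.arcs p) (conflicting p) meets)) (-‿inverseʳ 1#)

    -- An elementary path leaves each vertex at most once, so it cannot contain two arcs with a
    -- common tail.
    commonSource⇒tight : ∀ {u} → (∀ a → S a → src a ≡ u) → ∃[ i ] S (Path.arcs p i) →
      Tight (point S? 1#)
    commonSource⇒tight srcs = conflicting⇒tight (sourceRank-ranks srcs)
      λ q Si Sj → arcs-injective-src q (≡.trans (srcs _ Si) (≡.sym (srcs _ Sj)))

    commonSink⇒tight : ∀ {u} → (∀ a → S a → tgt a ≡ u) → ∃[ i ] S (Path.arcs p i) →
      Tight (point S? 1#)
    commonSink⇒tight tgts = conflicting⇒tight (sinkRank-ranks tgts)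
      λ q Si Sj → arcs-injective-tgt q (≡.trans (tgts _ Si) (≡.sym (tgts _ Sj)))

  -- By rest, the arc coordinates of the representatives form a triangular matrix
  -- once the arcs off p are listed before those of p.
  record Representative (a : Arc G) : Set (Level.suc 0ℓ ⊔ c ⊔ ℓ₁ ⊔ ℓ₂) where
    field
      {S}   : Pred (Arc G) 0ℓ
      S?    : Decidable S
      z     : Carrier
      tight : Tight (point S? z)
      a∈S   : S a
      rest  : ∀ {b} → S b → ¬ (b ≡ a) → OnPath p b × ¬ OnPath p a

  _∪?_ : ∀ {T : Pred (Arc G) 0ℓ} a → Decidable T → Decidable (λ b → b ≡ a ⊎ T b)
  (a ∪? T?) b = (b ≟ a) ⊎-dec T? b

  representative : .{{NonZero κ}} → ¬ (Path.source p ~ Path.sink p) → ∀ a → Representative a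
  representative ¬s~t a with onPath? p a
  ... | yes (i , ≡.refl) = record
    { S?    = _≟ a
    ; tight = commonSource⇒tight (_≟ a) (λ { _ ≡.refl → ≡.refl }) (i , ≡.refl)
    ; a∈S   = ≡.refl
    ; rest  = λ b≡a b≢a → contradiction b≡a b≢a
    }
  ... | no a∉p with Fin.any? (λ i → src (Path.arcs p i) Fin.≟ src a)
                  | Fin.any? (λ i → tgt (Path.arcs p i) Fin.≟ tgt a)
  ...   | yes (i , eq) | _ = record
    { S?    = a ∪? (_≟ Path.arcs p i)
    ; tight = commonSource⇒tight (a ∪? (_≟ Path.arcs p i))
        (λ { _ (inj₁ ≡.refl) → ≡.refl ; _ (inj₂ ≡.refl) → eq }) (i , inj₂ ≡.refl)
    ; a∈S   = inj₁ ≡.refl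
    ; rest  = λ where
        (inj₁ b≡a)    b≢a → contradiction b≡a b≢a
        (inj₂ ≡.refl) b≢a → (i , ≡.refl) , a∉p
    }
  ...   | no _ | yes (i , eq) = record
    { S?    = a ∪? (_≟ Path.arcs p i)
    ; tight = commonSink⇒tight (a ∪? (_≟ Path.arcs p i))
        (λ { _ (inj₁ ≡.refl) → ≡.refl ; _ (inj₂ ≡.refl) → eq }) (i , inj₂ ≡.refl)
    ; a∈S   = inj₁ ≡.refl
    ; rest  = λ where
        (inj₁ b≡a)    b≢a → contradiction b≡a b≢a
        (inj₂ ≡.refl) b≢a → (i , ≡.refl) , a∉p
    }
  -- No arc of `p` shares its tail or its head with `a`, so `a` could close a cycle with `p` only by
  -- running from sink to source, which nonadjacency excludes.
  ...   | no ¬leaves | no ¬enters = record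
    { S?    = a ∪? onPath? p
    ; tight = point-κ-feasible (a ∪? onPath? p) ranks ,
        trans (+-congʳ (sum-≈1 λ i → indicator-yes ((a ∪? onPath? p) (Path.arcs p i)) (inj₂ (i , ≡.refl))))
          (-‿inverseʳ (fromNat κ))
    ; a∈S   = inj₁ ≡.refl
    ; rest  = λ where
        (inj₁ b≡a) b≢a → contradiction b≡a b≢a
        (inj₂ b∈p) b≢a → b∈p , a∉p
    }
    where
    ranks : Ranks (λ b → b ≡ a ⊎ OnPath p b) (extensionRank p a)
    ranks b (inj₁ ≡.refl) = extensionRank-new p ¬s~t ¬leaves ¬enters
    ranks b (inj₂ b∈p)    = extensionRank-onPath p a b∈p

  -- Affine independence of the chosen points.

  module _ (rep : ∀ a → Representative a) where

    vertexOf : Arc G → Point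
    vertexOf a = point (Representative.S? (rep a)) (Representative.z (rep a))

    vertices : Fin (suc arcCount) → Point
    vertices = origin ∷ (vertexOf ∘ enumerate)

    vertices-face : ∀ i → vertices i ∈ Face (Polytope ℝ G κ) slack 0#
    vertices-face zero    = tight⇒face {origin} origin-tight
    vertices-face (suc j) = tight⇒face {vertexOf (enumerate j)} (Representative.tight (rep (enumerate j)))

    module _ (μ : Fin (suc arcCount) → Carrier)
             (∑μv≈0 : ∀ a → sum (λ i → μ i * vertices i a) ≈ 0#) where

      -- In the coordinate of the arc `enumerate j`, the origin contributes 0 and the point of `j`
      -- contributes `μ (suc j)`; any other point contributes only if its set contains the arc.
      coefficient≈0 : ∀ j →
        (∀ {i} → ¬ (j ≡ i) → Representative.S (rep (enumerate i)) (enumerate j) → μ (suc i) ≈ 0#) →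
        μ (suc j) ≈ 0#
      coefficient≈0 j others≈0 = begin
        μ (suc j)
          ≈⟨ *-identityʳ _ ⟨
        μ (suc j) * 1#
          ≈⟨ *-congˡ (indicator-yes (Representative.S? (rep a) a) (Representative.a∈S (rep a))) ⟨
        μ (suc j) * vertices (suc j) (inj₁ a)
          ≈⟨ sum-single (suc j) vanish ⟨
        sum (λ i → μ i * vertices i (inj₁ a))
          ≈⟨ ∑μv≈0 (inj₁ a) ⟩
        0#
          ∎
        where
        a : Arc G
        a = enumerate j

        vanish : ∀ i → ¬ (suc j ≡ i) → μ i * vertices i (inj₁ a) ≈ 0#
        vanish zero    _   = zeroʳ (μ zero)
        vanish (suc i) j≢i with Representative.S? (rep (enumerate i)) a
        ... | no _   = zeroʳ (μ (suc i))
        ... | yes Sa = trans (*-congʳ (others≈0 (j≢i ∘ ≡.cong suc) Sa)) (zeroˡ 1#)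

      rest-of : ∀ {i j} → ¬ (j ≡ i) → Representative.S (rep (enumerate i)) (enumerate j) →
        OnPath p (enumerate j) × ¬ OnPath p (enumerate i)
      rest-of {i} j≢i Sj = Representative.rest (rep (enumerate i)) Sj (j≢i ∘ enumerate-injective)

      -- By `rest`, an arc off `p` belongs to the set of no representative but its own.
      offPath≈0 : ∀ j → ¬ OnPath p (enumerate j) → μ (suc j) ≈ 0#
      offPath≈0 j j∉p = coefficient≈0 j λ j≢i Sj → contradiction (proj₁ (rest-of j≢i Sj)) j∉p

      -- Any other representative whose set contains the arc belongs to an arc off `p`, whose
      -- coefficient is already known to vanish.
      arcCoefficient≈0 : ∀ j → μ (suc j) ≈ 0#
      arcCoefficient≈0 j = coefficient≈0 j λ {i} j≢i Sj → offPath≈0 i (proj₂ (rest-of j≢i Sj))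

    -- The arc coordinates annihilate all coefficients but that of the origin, which then vanishes
    -- by the affine condition `sum μ ≈ 0#`.
    vertices-affinelyIndependent : AffinelyIndependent vertices
    vertices-affinelyIndependent μ ∑μ≈0 ∑μv≈0 zero = begin
      μ zero                    ≈⟨ +-identityʳ _ ⟨
      μ zero + 0#               ≈⟨ +-congˡ (sum-≈0 (arcCoefficient≈0 μ ∑μv≈0)) ⟨
      sum μ                     ≈⟨ ∑μ≈0 ⟩
      0#                        ∎
    vertices-affinelyIndependent μ ∑μ≈0 ∑μv≈0 (suc j) = arcCoefficient≈0 μ ∑μv≈0 j

  enumerateCoordinates : Fin (suc arcCount) → Coordinate ℝ G
  enumerateCoordinates = inj₂ tt ∷ (inj₁ ∘ enumerate)

  enumerateCoordinates-surjective : ∀ x → ∃[ i ] enumerateCoordinates i ≡ x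
  enumerateCoordinates-surjective (inj₂ tt) = zero , ≡.refl
  enumerateCoordinates-surjective (inj₁ a)  =
    let j , eq = enumerate-surjective a in suc j , ≡.cong inj₁ eq

  nonadjacent⇒facet : .{{NonZero κ}} → ¬ (Path.source p ~ Path.sink p) →
    DefinesFacet (Polytope ℝ G κ) slack 0#
  nonadjacent⇒facet ¬s~t = definesFacet slack-isLinear polytope-valid
    apex apex∈polytope slack-apex
    -- There are `arcCount + 1` coordinates, hence at most `arcCount + 2` affinely independent
    -- points, one more than `vertices` supplies.
    (affinelyIndependent⇒≤ enumerateCoordinates enumerateCoordinates-surjective)
    (vertices rep) (vertices-face rep) (vertices-affinelyIndependent rep)
    where
    rep : ∀ a → Representative a
    rep = representative ¬s~t

-- The rotation argument for a closed path.

module Rotation {c ℓ₁ ℓ₂} (ℝ : RealNumbers c ℓ₁ ℓ₂) {n} (G : SimpleGraph n) {k}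
                {x} (feasible : Feasible ℝ G (suc k) x) where
  open RealNumbers ℝ hiding (zero)
  open OrderedFieldProperties orderedField
  open BinarySums orderedField
  open SimpleGraph G
  open GraphProperties G
  open Feasible feasible
  open SetoidReasoning setoid

  w : Arc G → Carrier
  w = wᶜ ℝ G x

  z : Carrier
  z = zᶜ ℝ G x

  -- The invariant after `j` rotations: the current path attains `z`, and both its closing arc and
  -- its first `j` arcs carry 1.
  record FullUpTo (j : ℕ) : Set (c ⊔ ℓ₁) where
    field
      path      : Path G (suc k)
      closing   : Path.sink path ~ Path.source path
      saturated : pathSum ℝ G path w ≈ z
      closing≈1 : w (arc (Path.sink path) (Path.source path) closing) ≈ 1#
      full      : ∀ i → toℕ i ℕ.< j → w (Path.arcs path i) ≈ 1#

  -- Rotation exchanges the last arc of the path for the closing arc, which carries 1. If the last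
  -- arc carried 0, the rotated path would sum to `z + 1#`, against its path inequality; so it
  -- carries 1, and the sum is unchanged.
  fullUpTo-suc : ∀ {j} → FullUpTo j → FullUpTo (suc j)
  fullUpTo-suc {j} state with binary (Path.arcs (FullUpTo.path state) (fromℕ k))
  ... | inj₂ last≈1 = record
    { path      = rotate path closing
    ; closing   = rotate-closing path closing
    ; saturated = begin
        pathSum ℝ G (rotate path closing) w  ≈⟨ +-comm _ _ ⟩
        sum (init f) + w (arc (Path.sink path) (Path.source path) closing)
                                             ≈⟨ +-congˡ (trans closing≈1 (sym last≈1)) ⟩
        sum (init f) + last f                ≈⟨ sum-init-last f ⟨
        sum f                                ≈⟨ saturated ⟩
        z                                    ∎
    ; closing≈1 = last≈1
    ; full      = λ where
        zero    _         → closing≈1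
        (suc i) (ℕ.s≤s i<j) → full (inject₁ i) (≡.subst (ℕ._< j) (≡.sym (Fin.toℕ-inject₁ i)) i<j)
    }
    where
    open FullUpTo state

    f : Fin (suc k) → Carrier
    f = w ∘ Path.arcs path
  ... | inj₁ last≈0 = contradiction z<rotated (path≤z (rotate path closing))
    where
    open FullUpTo state

    f : Fin (suc k) → Carrier
    f = w ∘ Path.arcs path

    z<rotated : z < pathSum ℝ G (rotate path closing) w
    z<rotated = <-respʳ-≈ (begin
      z + 1#                   ≈⟨ +-cong saturated closing≈1 ⟨
      sum f + _                ≈⟨ +-congʳ (sum-init-last f) ⟩
      sum (init f) + last f + _  ≈⟨ +-congʳ (trans (+-congˡ last≈0) (+-identityʳ _)) ⟩
      sum (init f) + _         ≈⟨ +-comm _ _ ⟩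
      pathSum ℝ G (rotate path closing) w  ∎) (x<x+1 z)

  fullUpTo : FullUpTo 0 → ∀ j → FullUpTo j
  fullUpTo state zero    = state
  fullUpTo state (suc j) = fullUpTo-suc (fullUpTo state j)

  -- After `k + 1` rotations all `k + 2` arcs of the closed path carry 1, which violates the cycle
  -- inequality.
  ¬fullUpTo-0 : ¬ FullUpTo 0
  ¬fullUpTo-0 state = cycle≤ C (<-respʳ-≈ (sym full-cycle) (<-respʳ-≈ (x-y+y≈x _ 1#) (x<x+1 _)))
    where
    open FullUpTo (fullUpTo state (suc k))

    C : Cycle G
    C = record { path = path ; closing = closing }

    full-cycle : cycleSum ℝ G C w ≈ fromNat (Cycle.length C)
    full-cycle = +-cong closing≈1 (sum-≈1 λ i → full i (Fin.toℕ<n i))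

-- The adjacent case: no facet.

module ClosedPath {c ℓ₁ ℓ₂} (ℝ : RealNumbers c ℓ₁ ℓ₂) {n} (G : SimpleGraph n) {k} (p : Path G (suc k)) where
  open RealNumbers ℝ hiding (zero)
  open Polyhedral ℝ {Coordinate ℝ G}
  open OrderedFieldProperties orderedField
  open PolyhedralProperties ℝ {Coordinate ℝ G}
  open BinarySums orderedField
  open SimpleGraph G
  open GraphProperties G
  open PathFacet ℝ G p
  open Arc using (src)
  open SetoidReasoning setoid

  adjacent⇒¬facet : Path.source p ~ Path.sink p → ¬ DefinesFacet (Polytope ℝ G (suc k)) slack 0#
  -- The second hyperplane is given by the coordinate of the closing arc. `apex` lies in it but off
  -- the face; the closing arc alone with `z = κ` lies outside it.
  adjacent⇒¬facet s~t = ¬definesFacet slack-isLinear (coordinate-isLinear (inj₁ closingArc))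
    (conv-face-vanishing (Feasible ℝ G (suc k)) slack-isLinear slack≤0
      (coordinate-isLinear (inj₁ closingArc)) vanishing)
    apex apex∈polytope slack-apex refl
    v (⊆-conv (Feasible ℝ G (suc k)) v (point-κ-feasible (_≟ closingArc)
      (sourceRank-ranks {u = src closingArc} λ { _ ≡.refl → ≡.refl })))
    λ eq → 1≉0 (trans (sym (indicator-yes (closingArc ≟ closingArc) ≡.refl)) eq)
    where
    t~s : Path.sink p ~ Path.source p
    t~s = ~-sym s~t

    closingArc : Arc G
    closingArc = arc (Path.sink p) (Path.source p) t~s

    v : Point
    v = point (_≟ closingArc) (fromNat (suc k))

    -- Integrality of feasible points supplies the alternative that `conv-face-vanishing` asks for;
    -- before any rotation the condition `full` is vacuous.
    vanishing : ∀ x → Feasible ℝ G (suc k) x → wᶜ ℝ G x closingArc ≈ 0# ⊎ ¬ (slack x ≈ 0#)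
    vanishing x feasible with Feasible.binary feasible closingArc
    ... | inj₁ w≈0 = inj₁ w≈0
    ... | inj₂ w≈1 = inj₂ λ slack≈0 → Rotation.¬fullUpTo-0 ℝ G feasible record
      { path      = p
      ; closing   = t~s
      ; saturated = begin
          pathSum ℝ G p (wᶜ ℝ G x)  ≈⟨ x-y+y≈x _ (zᶜ ℝ G x) ⟨
          slack x + zᶜ ℝ G x        ≈⟨ +-congʳ slack≈0 ⟩
          0# + zᶜ ℝ G x             ≈⟨ +-identityˡ _ ⟩
          zᶜ ℝ G x                  ∎
      ; closing≈1 = w≈1
      ; full      = λ i ()
      }

theorem6 : ∀ {c ℓ₁ ℓ₂} (ℝ : RealNumbers c ℓ₁ ℓ₂) →
    let open RealNumbers ℝ
        open Polyhedral ℝ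
    in
    ∀ {n} (G : SimpleGraph n) (κ : ℕ) .{{_ : NonZero κ}} (p : Path G κ) →
    let open SimpleGraph G
        s = Path.source p
        t = Path.sink p
    in
    DefinesFacet (Polytope ℝ G κ) (λ x → pathSum ℝ G p (wᶜ ℝ G x) - zᶜ ℝ G x) 0#
      ⇔ (¬ (s ~ t))
-- `NonZero κ` leaves only the successor case, in which the path has a last arc for the rotation to
-- cut.
theorem6 ℝ G (suc k) p = mk⇔
  (λ facet s~t → ClosedPath.adjacent⇒¬facet ℝ G p s~t facet)
  (PathFacet.nonadjacent⇒facet ℝ G p)
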